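{- Let $G$ be a graph. The following are equivalent: (a1) $M_1(G)$ is a non-trivial matroid and $G$ is a connected cacti-graph; (a2) $M_1(G)$ is a connected matroid.
   Context: Graphs are finite, may have loops and parallel edges, and have no isolated vertices. A leaf is a vertex incident to exactly one edge, which is not a loop. A cacti-graph is a graph with no isolated vertices, no leaves, and no component that is a cycle. For $X\subseteq E(G)$, $G\langle X\rangle$ is the subgraph with edge set $X$ and vertex set the vertices incident to $X$. $M_1(G)$ is the matroid on $E(G)$ whose circuits are the inclusion-minimal members of $\{C\subseteq E(G):C\neq\emptyset,\ |C|=|V(G\langle C\rangle)|+1\}$. A matroid is non-trivial if it has at least one circuit and at least one cocircuit; it is connected if its ground set has at least two elements and every two elements lie in a common circuit. -}

module Defs where

open import Data.Bool.Base using (true; false)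
open import Data.Empty using (⊥-elim)
open import Data.Fin.Base using (Fin)
open import Data.Fin.Properties using (any?) renaming (_≟_ to _≟ᶠ_)
open import Data.Fin.Subset
open import Data.Fin.Subset.Properties
open import Data.Nat.Base using (ℕ; suc; _+_; _≤_; _<_; z≤n; s≤s; s≤s⁻¹)
open import Data.Nat.Properties
open import Data.Product using (_×_; _,_; proj₁; proj₂; ∃; ∃-syntax)
open import Data.Sum using (_⊎_; inj₁; inj₂)
open import Data.Vec.Base using ([]; _∷_; tabulate)
open import Data.Vec.Properties using (lookup⇒[]=; []=⇒lookup; lookup∘tabulate)
open import Induction.WellFounded using (Acc; acc)
open import Data.Nat.Induction using (<-wellFounded)
open import Relation.Binary.Construct.Closure.ReflexiveTransitive using (Star)
open import Relation.Binary.PropositionalEquality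
open import Relation.Nullary using (¬_; Dec; yes; no; does)
open import Relation.Nullary.Decidable using (_×-dec_; _⊎-dec_)

------------------------------------------------------------------------
-- Families of subsets of Fin m

Minimal Maximal : ∀ {m} → (Subset m → Set) → Subset m → Set
Minimal P X = P X × (∀ {Y} → P Y → Y ⊆ X → Y ≡ X)
Maximal P X = P X × (∀ {Y} → P Y → X ⊆ Y → Y ≡ X)

-- { x | P x }
separate : ∀ {n} {P : Fin n → Set} → (∀ x → Dec (P x)) → Subset n
separate P? = tabulate (λ x → does (P? x))

module _ {n} {P : Fin n → Set} (P? : ∀ x → Dec (P x)) where

  ∈-separate⁺ : ∀ {x} → P x → x ∈ separate P?
  ∈-separate⁺ {x} px with P? x in eq
  ... | yes _ = lookup⇒[]= x (separate P?) (trans (lookup∘tabulate _ x) (cong does eq))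
  ... | no ¬p = ⊥-elim (¬p px)

  ∈-separate⁻ : ∀ {x} → x ∈ separate P? → P x
  ∈-separate⁻ {x} x∈ with P? x in eq
  ... | yes p = p
  ... | no _ with () ← trans (sym ([]=⇒lookup x∈)) (trans (lookup∘tabulate _ x) (cong does eq))

------------------------------------------------------------------------
-- Matroids on Fin m, given by their circuits

record Matroid (m : ℕ) : Set₁ where
  field
    Circuit          : Subset m → Set
    circuit-nonempty : ∀ {C} → Circuit C → Nonempty C
    circuit-minimal  : ∀ {C D} → Circuit C → Circuit D → C ⊆ D → C ≡ D
    circuit-elim     : ∀ {C D e} → Circuit C → Circuit D → C ≢ D → e ∈ C → e ∈ D →
                       ∃[ F ] Circuit F × F ⊆ (C ∪ D) - e

  Independent : Subset m → Set
  Independent X = ∀ {C} → Circuit C → C ⊈ X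

  Basis : Subset m → Set
  Basis = Maximal Independent

  -- The bases of the dual matroid are the complements of the bases.
  DualBasis : Subset m → Set
  DualBasis B = Basis (∁ B)

  DualIndependent : Subset m → Set
  DualIndependent X = ∃[ B ] DualBasis B × X ⊆ B

  Cocircuit : Subset m → Set
  Cocircuit = Minimal (λ X → ¬ DualIndependent X)

  NonTrivial : Set
  NonTrivial = ∃ Circuit × ∃ Cocircuit

  IsConnectedMatroid : Set
  IsConnectedMatroid =
    2 ≤ m × (∀ e f → e ≢ f → ∃[ C ] Circuit C × e ∈ C × f ∈ C)

------------------------------------------------------------------------
-- Graphs with vertex set Fin n and edge set Fin m

-- Edges are undirected: the order of the two ends is immaterial to every
-- notion below.  Equal ends make a loop.
record Graph (n m : ℕ) : Set where
  field
    ends : Fin m → Fin n × Fin n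

module _ {n m : ℕ} (G : Graph n m) where
  open Graph G

  Incident : Fin m → Fin n → Set
  Incident e v = proj₁ (ends e) ≡ v ⊎ proj₂ (ends e) ≡ v

  incident? : ∀ e v → Dec (Incident e v)
  incident? e v = (proj₁ (ends e) ≟ᶠ v) ⊎-dec (proj₂ (ends e) ≟ᶠ v)

  Joins : Fin m → Fin n → Fin n → Set
  Joins e u v = ends e ≡ (u , v) ⊎ ends e ≡ (v , u)

  IsLoop : Fin m → Set
  IsLoop e = proj₁ (ends e) ≡ proj₂ (ends e)

  NoIsolatedVertices : Set
  NoIsolatedVertices = ∀ v → ∃[ e ] Incident e v

  IsLeaf : Fin n → Set
  IsLeaf v = ∃[ e ] Incident e v × (∀ f → Incident f v → f ≡ e) × ¬ IsLoop e

  record Subgraph : Set where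
    field
      vertices : Subset n
      edges    : Subset m
      closed   : ∀ {e v} → e ∈ edges → Incident e v → v ∈ vertices

open Subgraph

infix 4 _⊑_
_⊑_ : ∀ {n m} {G : Graph n m} → Subgraph G → Subgraph G → Set
H ⊑ K = vertices H ⊆ vertices K × edges H ⊆ edges K

module _ {n m : ℕ} (G : Graph n m) where
  open Graph G

  -- G itself, as a subgraph
  whole : Subgraph G
  whole = record { vertices = ⊤ ; edges = ⊤ ; closed = λ _ _ → ∈⊤ }

  -- The number of edge ends at v, so that a loop counts twice.
  degree : Subgraph G → Fin n → ℕ
  degree H v = ∣ edges H ∩ separate (λ e → proj₁ (ends e) ≟ᶠ v) ∣
             + ∣ edges H ∩ separate (λ e → proj₂ (ends e) ≟ᶠ v) ∣

  Adjacent : Subgraph G → Fin n → Fin n → Set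
  Adjacent H u v = ∃[ e ] e ∈ edges H × Joins G e u v

  IsConnectedSubgraph : Subgraph G → Set
  IsConnectedSubgraph H = Nonempty (vertices H) ×
    (∀ {u v} → u ∈ vertices H → v ∈ vertices H → Star (Adjacent H) u v)

  IsConnectedGraph : Set
  IsConnectedGraph = IsConnectedSubgraph whole

  IsComponent : Subgraph G → Set
  IsComponent H = IsConnectedSubgraph H ×
    (∀ (K : Subgraph G) → IsConnectedSubgraph K → H ⊑ K → K ⊑ H)

  -- A cycle is a connected 2-regular graph; a loop and a pair of parallel
  -- edges are cycles of lengths 1 and 2.
  IsCycle : Subgraph G → Set
  IsCycle H = IsConnectedSubgraph H × (∀ {v} → v ∈ vertices H → degree H v ≡ 2)

  IsCactiGraph : Set
  IsCactiGraph = NoIsolatedVertices G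
               × (∀ v → ¬ IsLeaf G v)
               × (∀ H → IsComponent H → ¬ IsCycle H)

  covered? : ∀ (X : Subset m) v → Dec (∃[ e ] e ∈ X × Incident G e v)
  covered? X v = any? (λ e → (e ∈? X) ×-dec incident? G e v)

  -- G⟨X⟩
  induced : Subset m → Subgraph G
  induced X = record
    { vertices = separate (covered? X)
    ; edges    = X
    ; closed   = λ e∈X e∼v → ∈-separate⁺ (covered? X) (_ , e∈X , e∼v)
    }

------------------------------------------------------------------------
-- Cardinality lemmas

∣∪∣+∣∩∣ : ∀ {n} (p q : Subset n) → ∣ p ∪ q ∣ + ∣ p ∩ q ∣ ≡ ∣ p ∣ + ∣ q ∣
∣∪∣+∣∩∣ [] [] = refl
∣∪∣+∣∩∣ (true ∷ p) (true ∷ q) = cong suc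
  (trans (+-suc _ _) (trans (cong suc (∣∪∣+∣∩∣ p q)) (sym (+-suc _ _))))
∣∪∣+∣∩∣ (true ∷ p) (false ∷ q) = cong suc (∣∪∣+∣∩∣ p q)
∣∪∣+∣∩∣ (false ∷ p) (true ∷ q) = trans (cong suc (∣∪∣+∣∩∣ p q)) (sym (+-suc _ _))
∣∪∣+∣∩∣ (false ∷ p) (false ∷ q) = ∣∪∣+∣∩∣ p q

∣p∣≤1+∣p-x∣ : ∀ {n} (p : Subset n) x → ∣ p ∣ ≤ suc ∣ p - x ∣
∣p∣≤1+∣p-x∣ p x = begin
  ∣ p ∣                                      ≤⟨ p⊆q⇒∣p∣≤∣q∣ p⊆ ⟩
  ∣ ⁅ x ⁆ ∪ (p - x) ∣                         ≤⟨ m≤m+n _ _ ⟩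
  ∣ ⁅ x ⁆ ∪ (p - x) ∣ + ∣ ⁅ x ⁆ ∩ (p - x) ∣   ≡⟨ ∣∪∣+∣∩∣ ⁅ x ⁆ (p - x) ⟩
  ∣ ⁅ x ⁆ ∣ + ∣ p - x ∣                       ≡⟨ cong (_+ ∣ p - x ∣) (∣⁅x⁆∣≡1 x) ⟩
  suc ∣ p - x ∣                              ∎
  where
  open ≤-Reasoning
  p⊆ : p ⊆ ⁅ x ⁆ ∪ (p - x)
  p⊆ {y} y∈p with y ≟ᶠ x
  ... | yes refl = x∈p∪q⁺ (inj₁ (x∈⁅x⁆ x))
  ... | no y≢x = x∈p∪q⁺ (inj₂ (x∈p∧x≢y⇒x∈p-y y∈p y≢x))

nonempty : ∀ {n} (p : Subset n) → 0 < ∣ p ∣ → Nonempty p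
nonempty {n} p 0<∣p∣ with nonempty? p
... | yes ne = ne
... | no e = ⊥-elim (<-irrefl (sym (trans (cong (∣_∣ {n = n}) (Empty-unique e)) (∣⊥∣≡0 n))) 0<∣p∣)

⊆∧⊄⇒≡ : ∀ {n} {p q : Subset n} → p ⊆ q → p ⊄ q → p ≡ q
⊆∧⊄⇒≡ {p = p} {q} p⊆q p⊄q = ⊆-antisym p⊆q q⊆p
  where
  q⊆p : q ⊆ p
  q⊆p {x} x∈q with x ∈? p
  ... | yes x∈p = x∈p
  ... | no x∉p = ⊥-elim (p⊄q (p⊆q , x , x∈q , x∉p))

⊆∧≢⇒⊂ : ∀ {n} {p q : Subset n} → p ⊆ q → p ≢ q → p ⊂ q
⊆∧≢⇒⊂ {p = p} {q} p⊆q p≢q with p ⊂? q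
... | yes p⊂q = p⊂q
... | no p⊄q = ⊥-elim (p≢q (⊆∧⊄⇒≡ p⊆q p⊄q))

------------------------------------------------------------------------
-- The matroid M₁(G)

module _ {n m : ℕ} (G : Graph n m) where

  V : Subset m → Subset n
  V X = vertices (induced G X)

  M₁-Circuit : Subset m → Set
  M₁-Circuit = Minimal (λ C → Nonempty C × ∣ C ∣ ≡ ∣ vertices (induced G C) ∣ + 1)

  V-mono : ∀ {X Y} → X ⊆ Y → V X ⊆ V Y
  V-mono {X} {Y} X⊆Y v∈ with ∈-separate⁻ (covered? G X) v∈
  ... | e , e∈X , e∼v = ∈-separate⁺ (covered? G Y) (e , X⊆Y e∈X , e∼v)

  V-∪ : ∀ X Y → V (X ∪ Y) ⊆ V X ∪ V Y
  V-∪ X Y v∈ with ∈-separate⁻ (covered? G (X ∪ Y)) v∈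
  ... | e , e∈ , e∼v with x∈p∪q⁻ X Y e∈
  ... | inj₁ e∈X = x∈p∪q⁺ (inj₁ (∈-separate⁺ (covered? G X) (e , e∈X , e∼v)))
  ... | inj₂ e∈Y = x∈p∪q⁺ (inj₂ (∈-separate⁺ (covered? G Y) (e , e∈Y , e∼v)))

  V-∩ : ∀ X Y → V (X ∩ Y) ⊆ V X ∩ V Y
  V-∩ X Y v∈ = x∈p∩q⁺ (V-mono (p∩q⊆p X Y) v∈ , V-mono (p∩q⊆q X Y) v∈)

  submodular : ∀ X Y → ∣ V (X ∪ Y) ∣ + ∣ V (X ∩ Y) ∣ ≤ ∣ V X ∣ + ∣ V Y ∣
  submodular X Y = ≤-trans
    (+-mono-≤ (p⊆q⇒∣p∣≤∣q∣ (V-∪ X Y)) (p⊆q⇒∣p∣≤∣q∣ (V-∩ X Y)))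
    (≤-reflexive (∣∪∣+∣∩∣ (V X) (V Y)))

  Over : Subset m → Set
  Over X = ∣ V X ∣ < ∣ X ∣

  member⇒over : ∀ {X} → ∣ X ∣ ≡ ∣ V X ∣ + 1 → Over X
  member⇒over eq = ≤-reflexive (sym (trans eq (+-comm _ 1)))

  over⇒circuit : ∀ X → Acc _<_ ∣ X ∣ → Over X → ∃[ C ] M₁-Circuit C × C ⊆ X
  over⇒circuit X (acc rec) over
    with anySubset? (λ Y → (Y ⊂? X) ×-dec (∣ V Y ∣ <? ∣ Y ∣))
  ... | yes (Y , Y⊂X , overY) with over⇒circuit Y (rec (p⊂q⇒∣p∣<∣q∣ Y⊂X)) overY
  ...   | C , circ , C⊆Y = C , circ , λ e∈ → proj₁ Y⊂X (C⊆Y e∈)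
  over⇒circuit X (acc rec) over | no ¬smaller =
    X , ((ne , trans (≤-antisym upper over) (+-comm 1 _)) , least) , λ e∈ → e∈
    where
    ne : Nonempty X
    ne = nonempty X (≤-trans (s≤s z≤n) over)
    e : Fin m
    e = proj₁ ne
    upper : ∣ X ∣ ≤ suc ∣ V X ∣
    upper = begin
      ∣ X ∣             ≤⟨ ∣p∣≤1+∣p-x∣ X e ⟩
      suc ∣ X - e ∣     ≤⟨ s≤s (≮⇒≥ λ o → ¬smaller (X - e , x∈p⇒p-x⊂p (proj₂ ne) , o)) ⟩
      suc ∣ V (X - e) ∣ ≤⟨ s≤s (p⊆q⇒∣p∣≤∣q∣ (V-mono (p─q⊆p X ⁅ e ⁆))) ⟩
      suc ∣ V X ∣       ∎
      where open ≤-Reasoning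
    least : ∀ {Y} → Nonempty Y × ∣ Y ∣ ≡ ∣ V Y ∣ + 1 → Y ⊆ X → Y ≡ X
    least {Y} (_ , eq) Y⊆X with Y ⊂? X
    ... | yes Y⊂X = ⊥-elim (¬smaller (Y , Y⊂X , member⇒over eq))
    ... | no Y⊄X = ⊆∧⊄⇒≡ Y⊆X Y⊄X

  proper⇒¬over : ∀ {C X} → M₁-Circuit C → X ⊂ C → ∣ X ∣ ≤ ∣ V X ∣
  proper⇒¬over {C} {X} (_ , least) X⊂C = ≮⇒≥ λ o → absurd (over⇒circuit X (<-wellFounded _) o)
    where
    absurd : ¬ (∃[ D ] M₁-Circuit D × D ⊆ X)
    absurd (D , (mem , _) , D⊆X) with least mem (λ e∈ → proj₁ X⊂C (D⊆X e∈))
    ... | refl = proj₂ (proj₂ (proj₂ X⊂C)) (D⊆X (proj₁ (proj₂ (proj₂ X⊂C))))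

  M₁-elim : ∀ {C D e} → M₁-Circuit C → M₁-Circuit D → C ≢ D → e ∈ C → e ∈ D →
            ∃[ F ] M₁-Circuit F × F ⊆ (C ∪ D) - e
  M₁-elim {C} {D} {e} c@((_ , eqC) , _) d@((neD , eqD) , leastD) C≢D _ _ =
    over⇒circuit U-e (<-wellFounded _) over
    where
    open ≤-Reasoning
    U I U-e : Subset m
    U = C ∪ D
    I = C ∩ D
    U-e = U - e
    I⊂C : I ⊂ C
    I⊂C = ⊆∧≢⇒⊂ (p∩q⊆p C D) λ I≡C →
      C≢D (leastD (proj₁ c) λ {x} x∈C → p∩q⊆q C D (subst (x ∈_) (sym I≡C) x∈C))
    counts : suc (suc (∣ V U ∣)) + ∣ V I ∣ ≤ ∣ U ∣ + ∣ V I ∣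
    counts = begin
      suc (suc (∣ V U ∣ + ∣ V I ∣))   ≤⟨ s≤s (s≤s (submodular C D)) ⟩
      suc (suc (∣ V C ∣ + ∣ V D ∣))   ≡⟨ cong suc (+-suc _ _) ⟨
      suc ∣ V C ∣ + suc ∣ V D ∣       ≤⟨ +-mono-≤ (member⇒over {C} eqC) (member⇒over {D} eqD) ⟩
      ∣ C ∣ + ∣ D ∣                   ≡⟨ ∣∪∣+∣∩∣ C D ⟨
      ∣ U ∣ + ∣ I ∣                   ≤⟨ +-monoʳ-≤ ∣ U ∣ (proper⇒¬over c I⊂C) ⟩
      ∣ U ∣ + ∣ V I ∣                 ∎
    over : Over U-e
    over = s≤s⁻¹ (begin
      suc (suc ∣ V U-e ∣) ≤⟨ s≤s (s≤s (p⊆q⇒∣p∣≤∣q∣ (V-mono (p─q⊆p U ⁅ e ⁆)))) ⟩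
      suc (suc ∣ V U ∣)   ≤⟨ +-cancelʳ-≤ ∣ V I ∣ _ _ counts ⟩
      ∣ U ∣               ≤⟨ ∣p∣≤1+∣p-x∣ U e ⟩
      suc ∣ U-e ∣         ∎)

  M₁ : Matroid m
  M₁ = record
    { Circuit          = M₁-Circuit
    ; circuit-nonempty = λ c → proj₁ (proj₁ c)
    ; circuit-minimal  = λ c d C⊆D → proj₂ d (proj₁ c) C⊆D
    ; circuit-elim     = M₁-elim
    }

{-# OPTIONS --safe #-}

-- With rank function r of M₁(G), always r(X) ≤ |V(X)|.  Equality holds whenever X is a union of
-- circuits.  Let G be connected with a circuit and without leaves, and let U be the set of edges
-- lying in circuits.  If U is not everything, then doubly counting the ends of the edges outside U
-- (two at each vertex missed by U, and one more where U meets its complement) gives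
-- |E ∖ U| > n − |V(U)|, so r(E) = r(U) + |E ∖ U| > n, which is absurd.  So every edge is in a
-- circuit.  Lying in a common circuit is transitive; if one of its classes A were not everything,
-- then r(A) + r(E ∖ A) = r(E) would make V(A) and V(E ∖ A) disjoint, and G would be disconnected.
--
-- Conversely, circuits of M₁(G) are connected, have no leaf, and have more edges than vertices,
-- hence lie in no 2-regular graph.
module Submission where

open import Data.Nat using (ℕ)
open import Data.Product using (_×_)
open import Function.Bundles using (_⇔_)
open import Defs
open import Data.Bool.Base using (Bool; true; false)
open import Data.Empty using (⊥-elim)
open import Data.Fin.Base using (Fin; zero; suc)
open import Data.Fin.Properties using (any?) renaming (_≟_ to _≟ᶠ_)
open import Data.Fin.Subset
open import Data.Fin.Subset.Properties
open import Data.Nat.Base using (suc; _+_; _≤_; _<_; z≤n; s≤s; s≤s⁻¹)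
open import Data.Nat.Induction using (<-wellFounded)
open import Data.Nat.Properties
open import Algebra.Properties.CommutativeMonoid.Sum +-0-commutativeMonoid using (sum; sum-cong-≗; ∑-distrib-+)
open import Data.Product using (_,_; proj₁; proj₂; ∃; ∃-syntax)
open import Data.Sum using (_⊎_; inj₁; inj₂; [_,_]′)
open import Data.Vec.Base using ([]; _∷_; here; there; tabulate)
open import Function.Base using (_∘_)
open import Function.Bundles using (mk⇔)
open import Induction.WellFounded using (Acc; acc)
open import Relation.Binary.Construct.Closure.ReflexiveTransitive using (Star; ε; _◅_; _◅◅_)
open import Relation.Binary.PropositionalEquality
open import Relation.Nullary using (¬_; Dec; yes; no; does)
open import Relation.Nullary.Decidable using (_×-dec_; ¬?; map′; decidable-stable)

private variable
  n m : ℕ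

-- Subsets and their cardinalities.

x∈p─q⇒x∉q : ∀ (p q : Subset m) {x} → x ∈ p ─ q → x ∉ q
x∈p─q⇒x∉q (_ ∷ p) (true ∷ q) () here
x∈p─q⇒x∉q (_ ∷ p) (_ ∷ q) (there x∈) (there x∈q) = x∈p─q⇒x∉q p q x∈ x∈q

x∈p-y⇒x≢y : ∀ (p : Subset m) {x y} → x ∈ p - y → x ≢ y
x∈p-y⇒x≢y p x∈ refl = x∈p─q⇒x∉q p ⁅ _ ⁆ x∈ (x∈⁅x⁆ _)

⊈⇒∃∉ : ∀ {p q : Subset m} → p ⊈ q → ∃[ x ] x ∈ p × x ∉ q
⊈⇒∃∉ {p = p} {q} p⊈q with any? (λ x → (x ∈? p) ×-dec ¬? (x ∈? q))
... | yes w = w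
... | no none = ⊥-elim (p⊈q sub)
  where
  sub : p ⊆ q
  sub {x} x∈p with x ∈? q
  ... | yes x∈q = x∈q
  ... | no x∉q = ⊥-elim (none (x , x∈p , x∉q))

∪-least : ∀ {p q r : Subset m} → p ⊆ r → q ⊆ r → p ∪ q ⊆ r
∪-least {p = p} {q} p⊆r q⊆r x∈ = [ p⊆r , q⊆r ]′ (x∈p∪q⁻ p q x∈)

∈∪ˡ : ∀ {p q : Subset m} {x} → x ∈ p → x ∈ p ∪ q
∈∪ˡ x∈p = x∈p∪q⁺ (inj₁ x∈p)

∈∪ʳ : ∀ {p q : Subset m} {x} → x ∈ q → x ∈ p ∪ q
∈∪ʳ x∈q = x∈p∪q⁺ (inj₂ x∈q)

Empty⇒∣∣≡0 : ∀ {p : Subset m} → Empty p → ∣ p ∣ ≡ 0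
Empty⇒∣∣≡0 {m} empty = trans (cong (∣_∣ {n = m}) (Empty-unique empty)) (∣⊥∣≡0 m)

∣∪∣-disjoint : ∀ {p q : Subset m} → (∀ {x} → x ∈ p → x ∉ q) → ∣ p ∪ q ∣ ≡ ∣ p ∣ + ∣ q ∣
∣∪∣-disjoint {p = p} {q} disj = begin
  ∣ p ∪ q ∣               ≡⟨ +-identityʳ _ ⟨
  ∣ p ∪ q ∣ + 0           ≡⟨ cong (∣ p ∪ q ∣ +_) (Empty⇒∣∣≡0 ∩-empty) ⟨
  ∣ p ∪ q ∣ + ∣ p ∩ q ∣   ≡⟨ ∣∪∣+∣∩∣ p q ⟩
  ∣ p ∣ + ∣ q ∣           ∎
  where
  open ≡-Reasoning
  ∩-empty : Empty (p ∩ q)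
  ∩-empty (_ , x∈) = disj (proj₁ (x∈p∩q⁻ p q x∈)) (proj₂ (x∈p∩q⁻ p q x∈))

⊆∧∣∣≥⇒⊇ : ∀ {p q : Subset m} → p ⊆ q → ∣ q ∣ ≤ ∣ p ∣ → q ⊆ p
⊆∧∣∣≥⇒⊇ {p = p} {q} p⊆q q≤p = subst (q ⊆_) (sym (⊆∧⊄⇒≡ p⊆q λ p⊂q →
  <⇒≱ (p⊂q⇒∣p∣<∣q∣ p⊂q) q≤p)) ⊆-refl

∣∣≤∣─∣+∣∩∣ : ∀ (p q : Subset m) → ∣ p ∣ ≤ ∣ p ─ q ∣ + ∣ p ∩ q ∣
∣∣≤∣─∣+∣∩∣ p q = begin
  ∣ p ∣                                   ≤⟨ p⊆q⇒∣p∣≤∣q∣ split ⟩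
  ∣ (p ─ q) ∪ (p ∩ q) ∣                   ≤⟨ m≤m+n _ _ ⟩
  ∣ (p ─ q) ∪ (p ∩ q) ∣ + ∣ (p ─ q) ∩ (p ∩ q) ∣ ≡⟨ ∣∪∣+∣∩∣ (p ─ q) (p ∩ q) ⟩
  ∣ p ─ q ∣ + ∣ p ∩ q ∣                   ∎
  where
  open ≤-Reasoning
  split : p ⊆ (p ─ q) ∪ (p ∩ q)
  split {x} x∈p with x ∈? q
  ... | yes x∈q = ∈∪ʳ (x∈p∩q⁺ (x∈p , x∈q))
  ... | no x∉q = ∈∪ˡ (x∈p∧x∉q⇒x∈p─q x∈p x∉q)

∈⇒1≤∣∣ : ∀ {p : Subset m} {x} → x ∈ p → 1 ≤ ∣ p ∣
∈⇒1≤∣∣ x∈p = ≤-trans (s≤s z≤n) (x∈p⇒∣p-x∣<∣p∣ x∈p)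

∈∈⇒2≤∣∣ : ∀ {p : Subset m} {x y} → x ∈ p → y ∈ p → y ≢ x → 2 ≤ ∣ p ∣
∈∈⇒2≤∣∣ x∈p y∈p y≢x = ≤-trans (s≤s (∈⇒1≤∣∣ (x∈p∧x≢y⇒x∈p-y y∈p y≢x))) (x∈p⇒∣p-x∣<∣p∣ x∈p)

-- Minimal and maximal members of a decidable family.

module _ {P : Subset m → Set} (P? : ∀ X → Dec (P X)) where

  minimal-below : ∀ {X} → P X → Acc _<_ ∣ X ∣ → ∃[ Y ] Minimal P Y × Y ⊆ X
  minimal-below {X} px (acc rec) with anySubset? (λ Y → P? Y ×-dec (Y ⊂? X))
  ... | yes (Y , py , Y⊂X) with minimal-below py (rec (p⊂q⇒∣p∣<∣q∣ Y⊂X))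
  ...   | Z , min , Z⊆Y = Z , min , λ x∈ → proj₁ Y⊂X (Z⊆Y x∈)
  minimal-below {X} px (acc rec) | no none =
    X , (px , λ {Y} py Y⊆X → ⊆∧⊄⇒≡ Y⊆X λ Y⊂X → none (Y , py , Y⊂X)) , λ x∈ → x∈

  maximal-above : ∀ {X} → P X → Acc _<_ ∣ ∁ X ∣ → ∃[ Y ] Maximal P Y × X ⊆ Y
  maximal-above {X} px (acc rec) with anySubset? (λ Y → P? Y ×-dec (X ⊂? Y))
  ... | yes (Y , py , X⊂Y) with maximal-above py (rec (p⊂q⇒∣p∣<∣q∣ (p⊂q⇒∁p⊃∁q X⊂Y)))
  ...   | Z , max , Y⊆Z = Z , max , λ x∈ → Y⊆Z (proj₁ X⊂Y x∈)
  maximal-above {X} px (acc rec) | no none =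
    X , (px , λ {Y} py X⊆Y → sym (⊆∧⊄⇒≡ X⊆Y λ X⊂Y → none (Y , py , X⊂Y))) , λ x∈ → x∈

  -- Minimality is rephrased as the absence of a proper subset satisfying `P`, which a finite search
  -- decides.
  minimal? : ∀ X → Dec (Minimal P X)
  minimal? X = map′
    (λ (px , none) → px , λ {Y} py Y⊆X → ⊆∧⊄⇒≡ Y⊆X λ Y⊂X → none (Y , py , Y⊂X))
    (λ (px , min) → px , λ (Y , py , Y⊂X) → ⊂-irref (min py (λ z → proj₁ Y⊂X z)) Y⊂X)
    (P? X ×-dec ¬? (anySubset? λ Y → P? Y ×-dec (Y ⊂? X)))

  maximal? : ∀ X → Dec (Maximal P X)
  maximal? X = map′
    (λ (px , none) → px , λ {Y} py X⊆Y → sym (⊆∧⊄⇒≡ X⊆Y λ X⊂Y → none (Y , py , X⊂Y)))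
    (λ (px , max) → px , λ (Y , py , X⊂Y) → ⊂-irref (sym (max py (λ z → proj₁ X⊂Y z))) X⊂Y)
    (P? X ×-dec ¬? (anySubset? λ Y → P? Y ×-dec (X ⊂? Y)))

-- Strong circuit elimination and transitivity of lying in a common circuit.

module _ (M : Matroid m) where
  open Matroid M

  circuit-⊈ : ∀ {C D e} → Circuit C → Circuit D → e ∈ D → e ∉ C → ∃[ f ] f ∈ C × f ∉ D
  circuit-⊈ cC cD e∈D e∉C = ⊈⇒∃∉ λ C⊆D →
    e∉C (subst (_ ∈_) (sym (circuit-minimal cC cD C⊆D)) e∈D)

  -- Induction on the size of `C ∪ D`. Weak elimination of `g` gives `F`. If `F` misses `e`, pick
  -- `f` in `F` outside `C`, hence in `D`. Since `D ∪ F` misses `e`, induction eliminates `f` from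
  -- `D` and `F` while keeping `g`, giving `H`. Since `C ∪ H` misses `f`, induction then eliminates
  -- `g` from `C` and `H` while keeping `e`.
  strong-elim : ∀ {C D e g} → Circuit C → Circuit D → g ∈ C → g ∈ D → e ∈ C → e ∉ D →
                Acc _<_ ∣ C ∪ D ∣ → ∃[ F ] Circuit F × F ⊆ (C ∪ D) - g × e ∈ F
  strong-elim {C} {D} {e} {g} cC cD g∈C g∈D e∈C e∉D (acc rec)
    with circuit-elim cC cD (λ C≡D → e∉D (subst (e ∈_) C≡D e∈C)) g∈C g∈D
  ... | F , cF , F⊆ with e ∈? F
  ...   | yes e∈F = F , cF , F⊆ , e∈F
  ...   | no e∉F with circuit-⊈ cF cC g∈C (λ g∈F → x∈p-y⇒x≢y _ (F⊆ g∈F) refl)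
  ...     | f , f∈F , f∉C
    with strong-elim cD cF f∈D f∈F g∈D (λ g∈F → x∈p-y⇒x≢y _ (F⊆ g∈F) refl)
           (rec (p⊂q⇒∣p∣<∣q∣ (D∪F⊆ , e , ∈∪ˡ e∈C , λ e∈ → [ e∉D , e∉F ]′ (x∈p∪q⁻ D F e∈))))
    where
    F⊆C∪D : F ⊆ C ∪ D
    F⊆C∪D x∈ = p─q⊆p _ ⁅ g ⁆ (F⊆ x∈)
    D∪F⊆ : D ∪ F ⊆ C ∪ D
    D∪F⊆ = ∪-least ∈∪ʳ F⊆C∪D
    f∈D : f ∈ D
    f∈D = [ (λ f∈C → ⊥-elim (f∉C f∈C)) , (λ f∈D → f∈D) ]′ (x∈p∪q⁻ C D (F⊆C∪D f∈F))
  ...     | H , cH , H⊆ , g∈H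
    with strong-elim cC cH g∈C g∈H e∈C e∉H
           (rec (p⊂q⇒∣p∣<∣q∣ (C∪H⊆ , f , F⊆C∪D f∈F , λ f∈ → [ f∉C , f∉H ]′ (x∈p∪q⁻ C H f∈))))
    where
    F⊆C∪D : F ⊆ C ∪ D
    F⊆C∪D x∈ = p─q⊆p _ ⁅ g ⁆ (F⊆ x∈)
    H⊆D∪F : H ⊆ D ∪ F
    H⊆D∪F x∈ = p─q⊆p _ ⁅ f ⁆ (H⊆ x∈)
    C∪H⊆ : C ∪ H ⊆ C ∪ D
    C∪H⊆ = ∪-least ∈∪ˡ λ x∈H → ∪-least ∈∪ʳ F⊆C∪D (H⊆D∪F x∈H)
    e∉H : e ∉ H
    e∉H e∈H = [ e∉D , e∉F ]′ (x∈p∪q⁻ D F (H⊆D∪F e∈H))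
    f∉H : f ∉ H
    f∉H f∈H = x∈p-y⇒x≢y _ (H⊆ f∈H) refl
  ...     | K , cK , K⊆ , e∈K = K , cK , K⊆' , e∈K
    where
    K⊆' : K ⊆ (C ∪ D) - g
    K⊆' x∈ = x∈p∧x≢y⇒x∈p-y
      (∪-least ∈∪ˡ (λ x∈H → ∪-least ∈∪ʳ (λ y∈F → p─q⊆p _ ⁅ g ⁆ (F⊆ y∈F))
                              (p─q⊆p _ ⁅ f ⁆ (H⊆ x∈H)))
        (p─q⊆p _ ⁅ g ⁆ (K⊆ x∈)))
      (x∈p-y⇒x≢y _ (K⊆ x∈))

  InCommonCircuit : Fin m → Fin m → Set
  InCommonCircuit e f = ∃[ C ] Circuit C × e ∈ C × f ∈ C

  -- Induction on the size of `C ∪ D`. Strong elimination of `g` gives circuits `F` through `e` and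
  -- `H` through `f`. Then `F` has some `x` in `D` outside `C`, and `H` has some `y` in `C` outside
  -- `D`. If `y` is in `F`, pass to `F` and `H`, whose union misses `g`; otherwise pass to `F` and
  -- `D`, which share `x` and whose union misses `y`.
  common-circuit : ∀ {C D e f g} → Circuit C → Circuit D → e ∈ C → f ∈ D → g ∈ C → g ∈ D →
                   Acc _<_ ∣ C ∪ D ∣ → InCommonCircuit e f
  common-circuit {C} {D} {e} {f} {g} cC cD e∈C f∈D g∈C g∈D (acc rec) with e ∈? D | f ∈? C
  ... | yes e∈D | _ = D , cD , e∈D , f∈D
  ... | no _ | yes f∈C = C , cC , e∈C , f∈C
  ... | no e∉D | no f∉C
    with strong-elim cC cD g∈C g∈D e∈C e∉D (<-wellFounded _)
       | strong-elim cD cC g∈D g∈C f∈D f∉C (<-wellFounded _)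
  ... | F , cF , F⊆ , e∈F | H , cH , H⊆ , f∈H
    with circuit-⊈ cF cC g∈C (λ g∈F → x∈p-y⇒x≢y _ (F⊆ g∈F) refl)
       | circuit-⊈ cH cD g∈D (λ g∈H → x∈p-y⇒x≢y _ (H⊆ g∈H) refl)
  ... | x , x∈F , x∉C | y , y∈H , y∉D with y ∈? F
  ... | yes y∈F = common-circuit cF cH e∈F f∈H y∈F y∈H (rec (p⊂q⇒∣p∣<∣q∣ (F∪H⊆ , g , ∈∪ˡ g∈C , g∉)))
    where
    F∪H⊆ : F ∪ H ⊆ C ∪ D
    F∪H⊆ = ∪-least (λ z∈ → p─q⊆p _ ⁅ g ⁆ (F⊆ z∈))
                   (λ z∈ → ∪-least ∈∪ʳ ∈∪ˡ (p─q⊆p _ ⁅ g ⁆ (H⊆ z∈)))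
    g∉ : g ∉ F ∪ H
    g∉ g∈ = [ (λ g∈F → x∈p-y⇒x≢y _ (F⊆ g∈F) refl)
            , (λ g∈H → x∈p-y⇒x≢y _ (H⊆ g∈H) refl) ]′ (x∈p∪q⁻ F H g∈)
  ... | no y∉F = common-circuit cF cD e∈F f∈D x∈F x∈D
                   (rec (p⊂q⇒∣p∣<∣q∣ (F∪D⊆ , y , ∈∪ˡ y∈C , y∉)))
    where
    F⊆C∪D : F ⊆ C ∪ D
    F⊆C∪D z∈ = p─q⊆p _ ⁅ g ⁆ (F⊆ z∈)
    F∪D⊆ : F ∪ D ⊆ C ∪ D
    F∪D⊆ = ∪-least F⊆C∪D ∈∪ʳ
    x∈D : x ∈ D
    x∈D = [ (λ x∈C → ⊥-elim (x∉C x∈C)) , (λ x∈D → x∈D) ]′ (x∈p∪q⁻ C D (F⊆C∪D x∈F))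
    y∈C : y ∈ C
    y∈C = [ (λ y∈D → ⊥-elim (y∉D y∈D)) , (λ y∈C → y∈C) ]′ (x∈p∪q⁻ D C (p─q⊆p _ ⁅ g ⁆ (H⊆ y∈H)))
    y∉ : y ∉ F ∪ D
    y∉ y∈ = [ y∉F , y∉D ]′ (x∈p∪q⁻ F D y∈)

  common-circuit-trans : ∀ {e f g} → InCommonCircuit e g → InCommonCircuit g f → InCommonCircuit e f
  common-circuit-trans (C , cC , e∈C , g∈C) (D , cD , g∈D , f∈D) =
    common-circuit cC cD e∈C f∈D g∈C g∈D (<-wellFounded _)

-- Sums of indicators

sum-mono : ∀ {f g : Fin n → ℕ} → (∀ i → f i ≤ g i) → sum f ≤ sum g
sum-mono {ℕ.zero} f≤g = z≤n
sum-mono {suc n} f≤g = +-mono-≤ (f≤g zero) (sum-mono (f≤g ∘ suc))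

𝟙 : Bool → ℕ
𝟙 true = 1
𝟙 false = 0

∣∷∣ : ∀ b (p : Subset m) → ∣ b ∷ p ∣ ≡ 𝟙 b + ∣ p ∣
∣∷∣ true p = refl
∣∷∣ false p = refl

sum-𝟙 : ∀ (b : Fin n → Bool) → sum (𝟙 ∘ b) ≡ ∣ tabulate b ∣
sum-𝟙 {ℕ.zero} b = refl
sum-𝟙 {suc n} b = trans (cong (𝟙 (b zero) +_) (sum-𝟙 (b ∘ suc))) (sym (∣∷∣ (b zero) (tabulate (b ∘ suc))))

χ : Subset n → Fin n → ℕ
χ p v = 𝟙 (does (v ∈? p))

sum-χ : ∀ (p : Subset n) → sum (χ p) ≡ ∣ p ∣
sum-χ p = trans (sum-𝟙 (λ v → does (v ∈? p))) (cong ∣_∣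
  (⊆-antisym (∈-separate⁻ (_∈? p)) (∈-separate⁺ (_∈? p))))

χ-∈ : ∀ {p : Subset n} {v} → v ∈ p → χ p v ≡ 1
χ-∈ {p = p} {v} v∈p with v ∈? p
... | yes _ = refl
... | no v∉p = ⊥-elim (v∉p v∈p)

χ-∉ : ∀ {p : Subset n} {v} → v ∉ p → χ p v ≡ 0
χ-∉ {p = p} {v} v∉p with v ∈? p
... | yes v∈p = ⊥-elim (v∉p v∈p)
... | no _ = refl

-- Each member of `p` is counted at exactly one vertex, its image under `s`. Applied to the two end
-- maps, this is the handshake identity.
sum-fibres : ∀ (p : Subset m) (s : Fin m → Fin n) →
             sum (λ v → ∣ p ∩ separate (λ e → s e ≟ᶠ v) ∣) ≡ ∣ p ∣
sum-fibres {n = n} [] s = trans (sum-𝟙 {n} (λ _ → false))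
  (Empty⇒∣∣≡0 {p = tabulate {n = n} (λ _ → false)} λ (v , v∈) → ∈-none v v∈)
  where
  ∈-none : ∀ {n} (v : Fin n) → v ∉ tabulate (λ _ → false)
  ∈-none (suc v) (there v∈) = ∈-none v v∈
sum-fibres (false ∷ p) s = sum-fibres p (s ∘ suc)
sum-fibres {n = n} (true ∷ p) s = begin
  sum (λ v → ∣ does (s zero ≟ᶠ v) ∷ fibre v ∣)
    ≡⟨ sum-cong-≗ (λ v → ∣∷∣ (does (s zero ≟ᶠ v)) (fibre v)) ⟩
  sum (λ v → 𝟙 (does (s zero ≟ᶠ v)) + ∣ fibre v ∣)
    ≡⟨ ∑-distrib-+ (λ v → 𝟙 (does (s zero ≟ᶠ v))) (∣_∣ ∘ fibre) ⟩
  sum (λ v → 𝟙 (does (s zero ≟ᶠ v))) + sum (∣_∣ ∘ fibre)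
    ≡⟨ cong₂ _+_ (trans (sum-𝟙 (λ v → does (s zero ≟ᶠ v))) point) (sum-fibres p (s ∘ suc)) ⟩
  suc ∣ p ∣ ∎
  where
  open ≡-Reasoning
  fibre : Fin n → Subset _
  fibre v = p ∩ separate (λ e → s (suc e) ≟ᶠ v)
  point : ∣ separate (s zero ≟ᶠ_) ∣ ≡ 1
  point = trans (cong ∣_∣ (⊆-antisym
    (λ v∈ → subst (_∈ ⁅ s zero ⁆) (∈-separate⁻ (s zero ≟ᶠ_) v∈) (x∈⁅x⁆ _))
    (λ v∈ → ∈-separate⁺ (s zero ≟ᶠ_) (sym (x∈⁅y⁆⇒x≡y _ v∈))))) (∣⁅x⁆∣≡1 (s zero))

star-crossing : ∀ {A : Set} {R : A → A → Set} {P : A → Set} → (∀ x → Dec (P x)) →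
                ∀ {x y} → Star R x y → P x → ¬ P y → ∃[ a ] ∃[ b ] R a b × P a × ¬ P b
star-crossing P? ε px ¬py = ⊥-elim (¬py px)
star-crossing P? (_◅_ {j = z} r rs) px ¬py with P? z
... | yes pz = star-crossing P? rs pz ¬py
... | no ¬pz = _ , z , r , px , ¬pz

-- Incidence and boundary vertices.

module _ (G : Graph n m) where
  open Graph G

  incident-∈V : ∀ {X e v} → e ∈ X → Incident G e v → v ∈ V G X
  incident-∈V {X} e∈X e∼v = ∈-separate⁺ (covered? G X) (_ , e∈X , e∼v)

  ∈V-incident : ∀ X {v} → v ∈ V G X → ∃[ e ] e ∈ X × Incident G e v
  ∈V-incident X = ∈-separate⁻ (covered? G X)

  joins-incidentˡ : ∀ {e u v} → Joins G e u v → Incident G e u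
  joins-incidentˡ (inj₁ eq) = inj₁ (cong proj₁ eq)
  joins-incidentˡ (inj₂ eq) = inj₂ (cong proj₂ eq)

  joins-incidentʳ : ∀ {e u v} → Joins G e u v → Incident G e v
  joins-incidentʳ (inj₁ eq) = inj₂ (cong proj₂ eq)
  joins-incidentʳ (inj₂ eq) = inj₁ (cong proj₁ eq)

  -- An end of `f` in `V G U` is already a witness. Otherwise a path from an end of `e` to an end of
  -- `f` leaves `V G U` along some edge; its far end is not covered by `U`, so that edge is outside
  -- `U`.
  boundary : IsConnectedGraph G → ∀ {U e f} → e ∈ U → f ∉ U →
             ∃[ v ] v ∈ V G U × v ∈ V G (∁ U)
  boundary (_ , conn) {U} {e} {f} e∈U f∉U with proj₁ (ends f) ∈? V G U
  ... | yes v∈ = _ , v∈ , incident-∈V (x∉p⇒x∈∁p f∉U) (inj₁ refl)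
  ... | no v∉ with star-crossing (_∈? V G U) (conn ∈⊤ ∈⊤) (incident-∈V e∈U (inj₁ refl)) v∉
  ...   | a , b , (g , _ , g-joins) , a∈ , b∉ =
    a , a∈ , incident-∈V
      (x∉p⇒x∈∁p λ g∈U → b∉ (incident-∈V g∈U (joins-incidentʳ g-joins)))
      (joins-incidentˡ g-joins)

  -- Degrees

  starts finishes : Fin n → Subset m
  starts v = separate (λ e → proj₁ (ends e) ≟ᶠ v)
  finishes v = separate (λ e → proj₂ (ends e) ≟ᶠ v)

  handshake : ∀ X → sum (degree G (induced G X)) ≡ ∣ X ∣ + ∣ X ∣
  handshake X = trans
    (∑-distrib-+ (λ v → ∣ X ∩ starts v ∣) (λ v → ∣ X ∩ finishes v ∣))
    (cong₂ _+_ (sum-fibres X (proj₁ ∘ ends)) (sum-fibres X (proj₂ ∘ ends)))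

  incidence : ∀ {X e v} → e ∈ X → Incident G e v → e ∈ X ∩ starts v ⊎ e ∈ X ∩ finishes v
  incidence {v = v} e∈X (inj₁ eq) = inj₁ (x∈p∩q⁺ (e∈X , ∈-separate⁺ (λ e → proj₁ (ends e) ≟ᶠ v) eq))
  incidence {v = v} e∈X (inj₂ eq) = inj₂ (x∈p∩q⁺ (e∈X , ∈-separate⁺ (λ e → proj₂ (ends e) ≟ᶠ v) eq))

  degree-mono : ∀ (H K : Subgraph G) v → H ⊑ K → degree G H v ≤ degree G K v
  degree-mono H K v (_ , H⊆K) = +-mono-≤ (half (starts v)) (half (finishes v))
    where
    half : ∀ S → ∣ Subgraph.edges H ∩ S ∣ ≤ ∣ Subgraph.edges K ∩ S ∣
    half S = p⊆q⇒∣p∣≤∣q∣ λ e∈ → let (e∈H , e∈S) = x∈p∩q⁻ _ S e∈ in x∈p∩q⁺ (H⊆K e∈H , e∈S)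

  degree≥1 : ∀ {X v} → v ∈ V G X → 1 ≤ degree G (induced G X) v
  degree≥1 {X} v∈ with ∈V-incident X v∈
  ... | e , e∈X , e∼v with incidence e∈X e∼v
  ... | inj₁ e∈ = ≤-trans (∈⇒1≤∣∣ e∈) (m≤m+n _ _)
  ... | inj₂ e∈ = ≤-trans (∈⇒1≤∣∣ e∈) (m≤n+m _ _)

  degree≡0 : ∀ {X v} → v ∉ V G X → degree G (induced G X) v ≡ 0
  degree≡0 {X} {v} v∉ = cong₂ _+_
    (Empty⇒∣∣≡0 λ (e , e∈) → let (e∈X , e∈S) = x∈p∩q⁻ X (starts v) e∈ in
       v∉ (incident-∈V e∈X (inj₁ (∈-separate⁻ (λ e → proj₁ (ends e) ≟ᶠ v) e∈S))))
    (Empty⇒∣∣≡0 λ (e , e∈) → let (e∈X , e∈S) = x∈p∩q⁻ X (finishes v) e∈ in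
       v∉ (incident-∈V e∈X (inj₂ (∈-separate⁻ (λ e → proj₂ (ends e) ≟ᶠ v) e∈S))))

  -- Either a second edge meets `v`, or `e` is the only one; in the latter case `e` must be a loop,
  -- which counts twice, for otherwise `v` would be a leaf.
  degree≥2 : ∀ {X e v} → (∀ {f} → Incident G f v → f ∈ X) → Incident G e v → ¬ IsLeaf G v →
             2 ≤ degree G (induced G X) v
  degree≥2 {X} {e} {v} all e∼v ¬leaf with any? (λ f → incident? G f v ×-dec ¬? (f ≟ᶠ e))
  ... | yes (f , f∼v , f≢e) with incidence (all e∼v) e∼v | incidence (all f∼v) f∼v
  ...   | inj₁ e∈ | inj₁ f∈ = ≤-trans (∈∈⇒2≤∣∣ e∈ f∈ f≢e) (m≤m+n _ _)
  ...   | inj₁ e∈ | inj₂ f∈ = +-mono-≤ (∈⇒1≤∣∣ e∈) (∈⇒1≤∣∣ f∈)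
  ...   | inj₂ e∈ | inj₁ f∈ = +-mono-≤ (∈⇒1≤∣∣ f∈) (∈⇒1≤∣∣ e∈)
  ...   | inj₂ e∈ | inj₂ f∈ = ≤-trans (∈∈⇒2≤∣∣ e∈ f∈ f≢e) (m≤n+m _ _)
  degree≥2 {X} {e} {v} all e∼v ¬leaf | no none with proj₁ (ends e) ≟ᶠ proj₂ (ends e)
  ... | no ¬loop = ⊥-elim (¬leaf (e , e∼v , only , ¬loop))
    where
    only : ∀ f → Incident G f v → f ≡ e
    only f f∼v = decidable-stable (f ≟ᶠ e) λ f≢e → none (f , f∼v , f≢e)
  ... | yes loop = +-mono-≤
    (∈⇒1≤∣∣ (x∈p∩q⁺ (all e∼v , ∈-separate⁺ (λ e → proj₁ (ends e) ≟ᶠ v) start)))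
    (∈⇒1≤∣∣ (x∈p∩q⁺ (all e∼v , ∈-separate⁺ (λ e → proj₂ (ends e) ≟ᶠ v) (trans (sym loop) start))))
    where
    start : proj₁ (ends e) ≡ v
    start = [ (λ eq → eq) , trans loop ]′ e∼v

-- Circuits and independent sets of `M₁ G`.

module _ {n m} (G : Graph n m) where
  open Graph G
  open Matroid (M₁ G)

  private
    ν : Subset m → ℕ
    ν X = ∣ V G X ∣

  circuit-over : ∀ {C} → Circuit C → ν C < ∣ C ∣
  circuit-over {C} ((_ , eq) , _) = member⇒over G {C} eq

  circuit-size : ∀ {C} → Circuit C → 2 ≤ ∣ C ∣
  circuit-size {C} cC = ≤-trans
    (s≤s (∈⇒1≤∣∣ (incident-∈V G (proj₂ (circuit-nonempty cC)) (inj₁ refl)))) (circuit-over cC)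

  circuit? : ∀ X → Dec (Circuit X)
  circuit? = minimal? (λ C → nonempty? C ×-dec (∣ C ∣ ≟ ν C + 1))

  dependent? : ∀ X → Dec (∃[ C ] Circuit C × C ⊆ X)
  dependent? X = anySubset? (λ C → circuit? C ×-dec (C ⊆? X))

  independent? : ∀ X → Dec (Independent X)
  independent? X with dependent? X
  ... | yes (C , cC , C⊆X) = no λ ind → ind cC C⊆X
  ... | no none = yes λ cC C⊆X → none (_ , cC , C⊆X)

  independent-⊥ : Independent ⊥
  independent-⊥ cC C⊆⊥ = ∉⊥ (C⊆⊥ (proj₂ (circuit-nonempty cC)))

  independent-⊆ : ∀ {X Y} → X ⊆ Y → Independent Y → Independent X
  independent-⊆ X⊆Y ind cC C⊆X = ind cC (λ x∈ → X⊆Y (C⊆X x∈))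

  independent⇒≤ : ∀ {X} → Independent X → ∣ X ∣ ≤ ν X
  independent⇒≤ {X} ind = ≮⇒≥ λ over →
    let (C , cC , C⊆X) = over⇒circuit G X (<-wellFounded _) over in ind cC C⊆X

  inCommonCircuit? : ∀ e f → Dec (InCommonCircuit (M₁ G) e f)
  inCommonCircuit? e f = anySubset? (λ C → circuit? C ×-dec (e ∈? C) ×-dec (f ∈? C))

  commonCircuitClass : Fin m → Subset m
  commonCircuitClass e = separate (inCommonCircuit? e)

  commonCircuit⁺ : ∀ {e f} → InCommonCircuit (M₁ G) e f → f ∈ commonCircuitClass e
  commonCircuit⁺ {e} = ∈-separate⁺ (inCommonCircuit? e)

  commonCircuit⁻ : ∀ {e f} → f ∈ commonCircuitClass e → InCommonCircuit (M₁ G) e f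
  commonCircuit⁻ {e} = ∈-separate⁻ (inCommonCircuit? e)

  -- The complement of the set of coloops.
  circuitElements : Subset m
  circuitElements = separate (λ e → inCommonCircuit? e e)

  circuitElements⁻ : ∀ {e} → e ∈ circuitElements → InCommonCircuit (M₁ G) e e
  circuitElements⁻ = ∈-separate⁻ (λ e → inCommonCircuit? e e)

  circuit⊆ : ∀ {C} → Circuit C → C ⊆ circuitElements
  circuit⊆ {C} cC e∈C = ∈-separate⁺ (λ e → inCommonCircuit? e e) (C , cC , e∈C , e∈C)

  IsUnionOfCircuits : Subset m → Set
  IsUnionOfCircuits X = ∀ {x} → x ∈ X → ∃[ C ] Circuit C × x ∈ C × C ⊆ X

  circuitElements-isUnion : IsUnionOfCircuits circuitElements
  circuitElements-isUnion x∈ =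
    let (C , cC , x∈C , _) = circuitElements⁻ x∈ in C , cC , x∈C , circuit⊆ cC

  -- Unions of circuits have full rank

  -- The rank of `X` attains its upper bound `ν X`, expressed through an independent witness in
  -- place of a rank function.
  HasFullRank : Subset m → Set
  HasFullRank X = ∃[ T ] T ⊆ X × Independent T × ν X ≤ ∣ T ∣

  -- I is a maximal independent subset of X, and T a largest tight (|T| = |V(T)|) subset of I; tight
  -- subsets of I are closed under union.  A circuit with an edge of I outside T would violate the
  -- independence of I, so T meets every vertex of X.
  full-rank : ∀ X → IsUnionOfCircuits X → HasFullRank X
  full-rank X circuits
    with maximal-above {P = λ Z → Independent Z × Z ⊆ X} (λ Z → independent? Z ×-dec (Z ⊆? X))
           {⊥} (independent-⊥ , λ x∈ → ⊥-elim (∉⊥ x∈)) (<-wellFounded _)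
  ... | I , ((indI , I⊆X) , maxI) , _
    with maximal-above {P = λ Z → Z ⊆ I × ν Z ≤ ∣ Z ∣} (λ Z → (Z ⊆? I) ×-dec (ν Z ≤? ∣ Z ∣))
           {⊥} ((λ x∈ → ⊥-elim (∉⊥ x∈)) , ≤-trans (≤-reflexive (Empty⇒∣∣≡0 V⊥-empty)) z≤n)
           (<-wellFounded _)
    where
    V⊥-empty : Empty (V G ⊥)
    V⊥-empty (v , v∈) = ∉⊥ (proj₁ (proj₂ (∈V-incident G ⊥ v∈)))
  ... | T , ((T⊆I , tightT) , maxT) , _ =
    T , (λ x∈ → I⊆X (T⊆I x∈)) , independent-⊆ T⊆I indI ,
    ≤-trans (p⊆q⇒∣p∣≤∣q∣ VX⊆VT) tightT
    where
    open ≤-Reasoning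

    -- By submodularity of `ν`: the intersection `T ∩ Z` is independent, so it has at most
    -- `ν (T ∩ Z)` edges, and the union must be tight.
    tight-∪ : ∀ {Z} → Z ⊆ I → ν Z ≤ ∣ Z ∣ → ν (T ∪ Z) ≤ ∣ T ∪ Z ∣
    tight-∪ {Z} Z⊆I tightZ = +-cancelʳ-≤ (ν (T ∩ Z)) _ _ (begin
      ν (T ∪ Z) + ν (T ∩ Z)     ≤⟨ submodular G T Z ⟩
      ν T + ν Z                 ≤⟨ +-mono-≤ tightT tightZ ⟩
      ∣ T ∣ + ∣ Z ∣             ≡⟨ ∣∪∣+∣∩∣ T Z ⟨
      ∣ T ∪ Z ∣ + ∣ T ∩ Z ∣     ≤⟨ +-monoʳ-≤ ∣ T ∪ Z ∣ (independent⇒≤ (independent-⊆ T∩Z⊆I indI)) ⟩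
      ∣ T ∪ Z ∣ + ν (T ∩ Z)     ∎)
      where
      T∩Z⊆I : T ∩ Z ⊆ I
      T∩Z⊆I x∈ = T⊆I (p∩q⊆p T Z x∈)

    absorb : ∀ {Z} → Z ⊆ I → ν Z ≤ ∣ Z ∣ → Z ⊆ T
    absorb {Z} Z⊆I tightZ x∈Z =
      subst (_ ∈_) (maxT (∪-least T⊆I Z⊆I , tight-∪ Z⊆I tightZ) ∈∪ˡ) (∈∪ʳ x∈Z)

    -- The fundamental circuit of x over I, less x, is tight and still meets the ends of x.
    outside-ends : ∀ {x v} → x ∈ X → x ∉ I → Incident G x v → v ∈ V G T
    outside-ends {x} {v} x∈X x∉I x∼v with dependent? (I ∪ ⁅ x ⁆)
    ... | no none = ⊥-elim (x∉I (subst (x ∈_)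
            (maxI ((λ cC C⊆ → none (_ , cC , C⊆)) , ∪-least I⊆X x⊆X) ∈∪ˡ) (∈∪ʳ (x∈⁅x⁆ x))))
      where
      x⊆X : ⁅ x ⁆ ⊆ X
      x⊆X y∈ = subst (_∈ X) (sym (x∈⁅y⁆⇒x≡y x y∈)) x∈X
    ... | yes (C , cC , C⊆I+x) =
      V-mono G (absorb C-x⊆I (≤-trans (p⊆q⇒∣p∣≤∣q∣ V-x⊆) νC≤)) v∈
      where
      C-x⊆I : C - x ⊆ I
      C-x⊆I y∈ = [ (λ y∈I → y∈I)
                 , (λ y∈ˣ → ⊥-elim (x∈p-y⇒x≢y C y∈ (x∈⁅y⁆⇒x≡y x y∈ˣ))) ]′
                 (x∈p∪q⁻ I ⁅ x ⁆ (C⊆I+x (p─q⊆p C ⁅ x ⁆ y∈)))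
      V-x⊆ : V G (C - x) ⊆ V G C
      V-x⊆ = V-mono G (p─q⊆p C ⁅ x ⁆)
      νC≤ : ν C ≤ ∣ C - x ∣
      νC≤ = s≤s⁻¹ (≤-trans (circuit-over cC) (∣p∣≤1+∣p-x∣ C x))
      x∈C : x ∈ C
      x∈C = decidable-stable (x ∈? C) λ x∉C → indI cC λ y∈C →
        C-x⊆I (x∈p∧x≢y⇒x∈p-y y∈C λ { refl → x∉C y∈C })
      v∈ : v ∈ V G (C - x)
      -- As a subset of `I`, `C - x` has at most `ν (C - x)` edges, so
      -- `ν C ≤ ∣ C - x ∣ ≤ ν (C - x)`: removing `x` uncovers no vertex.
      v∈ = ⊆∧∣∣≥⇒⊇ V-x⊆ (≤-trans νC≤ (independent⇒≤ (independent-⊆ C-x⊆I indI)))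
             (incident-∈V G x∈C x∼v)

    -- Split `C` into `D`, its edges in `I` outside `T`, and the rest `C′`, which is proper because
    -- of `y`. Every vertex of `C′` is in both `V G T` and `V G C`. As `T ∪ D` is independent,
    -- counting vertices bounds `∣ T ∣ + ∣ C ∣` by `ν T + ν C`, although `T` is tight and `C` has
    -- more edges than vertices.
    circuit-absorbed : ∀ {C} → Circuit C → C ⊆ X → ∀ {y} → y ∈ C → y ∈ I → y ∈ T
    circuit-absorbed {C} cC C⊆X {y} y∈C y∈I with y ∈? T
    ... | yes y∈T = y∈T
    ... | no y∉T = ⊥-elim (<-irrefl refl (begin-strict
      ∣ T ∣ + ∣ C ∣                               ≤⟨ +-monoʳ-≤ ∣ T ∣ (∣∣≤∣─∣+∣∩∣ C K) ⟩
      ∣ T ∣ + (∣ D ∣ + ∣ C′ ∣)                    ≡⟨ +-assoc ∣ T ∣ _ _ ⟨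
      ∣ T ∣ + ∣ D ∣ + ∣ C′ ∣                      ≡⟨ cong (_+ ∣ C′ ∣) (∣∪∣-disjoint {p = T} {D} T∩D) ⟨
      ∣ T ∪ D ∣ + ∣ C′ ∣                          ≤⟨ +-mono-≤ (independent⇒≤ (independent-⊆ T∪D⊆I indI)) (proper⇒¬over G cC C′⊂C) ⟩
      ν (T ∪ D) + ν C′                            ≤⟨ +-mono-≤ (p⊆q⇒∣p∣≤∣q∣ V∪) (p⊆q⇒∣p∣≤∣q∣ V∩) ⟩
      ∣ V G T ∪ V G C ∣ + ∣ V G T ∩ V G C ∣       ≡⟨ ∣∪∣+∣∩∣ (V G T) (V G C) ⟩
      ν T + ν C                                   <⟨ +-mono-≤-< tightT (circuit-over cC) ⟩
      ∣ T ∣ + ∣ C ∣                               ∎))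
      where
      K D C′ : Subset m
      K = T ∪ ∁ I
      D = C ─ K
      C′ = C ∩ K
      ∈D⇒∉T : ∀ {x} → x ∈ D → x ∉ T
      ∈D⇒∉T x∈D x∈T = x∈p─q⇒x∉q C K x∈D (∈∪ˡ x∈T)
      T∩D : ∀ {x} → x ∈ T → x ∉ D
      T∩D x∈T x∈D = ∈D⇒∉T x∈D x∈T
      T∪D⊆I : T ∪ D ⊆ I
      T∪D⊆I = ∪-least T⊆I λ {x} x∈D → x∉∁p⇒x∈p λ x∈∁I → x∈p─q⇒x∉q C K x∈D (∈∪ʳ x∈∁I)
      C′⊂C : C′ ⊂ C
      C′⊂C = p∩q⊆p C K , y , y∈C , λ y∈C′ →
        [ y∉T , x∈p⇒x∉∁p y∈I ]′ (x∈p∪q⁻ T (∁ I) (p∩q⊆q C K y∈C′))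
      V∪ : V G (T ∪ D) ⊆ V G T ∪ V G C
      V∪ v∈ = ∪-least ∈∪ˡ (λ v∈D → ∈∪ʳ (V-mono G (p─q⊆p C K) v∈D)) (V-∪ G T D v∈)
      V∩ : V G C′ ⊆ V G T ∩ V G C
      V∩ v∈ with ∈V-incident G C′ v∈
      ... | e , e∈C′ , e∼v with x∈p∩q⁻ C K e∈C′
      ... | e∈C , e∈K with x∈p∪q⁻ T (∁ I) e∈K
      ... | inj₁ e∈T = x∈p∩q⁺ (incident-∈V G e∈T e∼v , incident-∈V G e∈C e∼v)
      ... | inj₂ e∈∁I = x∈p∩q⁺ (outside-ends (C⊆X e∈C) (x∈∁p⇒x∉p e∈∁I) e∼v , incident-∈V G e∈C e∼v)

    VX⊆VT : V G X ⊆ V G T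
    VX⊆VT v∈ with ∈V-incident G X v∈
    ... | e , e∈X , e∼v with e ∈? I
    ... | no e∉I = outside-ends e∈X e∉I e∼v
    ... | yes e∈I with circuits e∈X
    ... | C , cC , e∈C , C⊆X = incident-∈V G (circuit-absorbed cC C⊆X e∈C e∈I) e∼v

  -- Separators and their vertex sets.

  IsSeparator : Subset m → Set
  IsSeparator A = ∀ {C} → Circuit C → C ⊆ A ⊎ C ⊆ ∁ A

  -- A circuit inside `S ∪ T` lies in `A` or in `∁ A`, hence in `S` or in `T`; so `S ∪ T` is
  -- independent.
  separator-rank : ∀ {A S T} → IsSeparator A → S ⊆ A → T ⊆ ∁ A → Independent S → Independent T →
                   ∣ S ∣ + ∣ T ∣ ≤ ν (S ∪ T)
  separator-rank {A} {S} {T} sep S⊆A T⊆∁A indS indT =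
    ≤-trans (≤-reflexive (sym (∣∪∣-disjoint {p = S} {T} disjoint))) (independent⇒≤ indep)
    where
    disjoint : ∀ {x} → x ∈ S → x ∉ T
    disjoint x∈S x∈T = x∈∁p⇒x∉p (T⊆∁A x∈T) (S⊆A x∈S)
    indep : Independent (S ∪ T)
    indep {C} cC C⊆ with sep cC
    ... | inj₁ C⊆A = indS cC λ x∈ → [ (λ x∈S → x∈S)
                     , (λ x∈T → ⊥-elim (x∈∁p⇒x∉p (T⊆∁A x∈T) (C⊆A x∈))) ]′ (x∈p∪q⁻ S T (C⊆ x∈))
    ... | inj₂ C⊆∁A = indT cC λ x∈ → [ (λ x∈S → ⊥-elim (x∈∁p⇒x∉p (C⊆∁A x∈) (S⊆A x∈S)))
                     , (λ x∈T → x∈T) ]′ (x∈p∪q⁻ S T (C⊆ x∈))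

  -- The independent witnesses combine to show that `ν A + ν (∁ A)` is at most the size of
  -- `V G A ∪ V G (∁ A)`, which leaves nothing for the intersection.
  separator-V-disjoint : ∀ {A} → IsSeparator A → HasFullRank A → HasFullRank (∁ A) →
                         ¬ (∃[ v ] v ∈ V G A × v ∈ V G (∁ A))
  separator-V-disjoint {A} sep (S , S⊆A , indS , νA≤) (T , T⊆∁A , indT , ν∁A≤) (v , v∈VA , v∈V∁A) =
    <⇒≱ (∈⇒1≤∣∣ (x∈p∩q⁺ (v∈VA , v∈V∁A))) (+-cancelˡ-≤ ∣ V G A ∪ V G (∁ A) ∣ _ _ (begin
      ∣ V G A ∪ V G (∁ A) ∣ + ∣ V G A ∩ V G (∁ A) ∣   ≡⟨ ∣∪∣+∣∩∣ (V G A) (V G (∁ A)) ⟩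
      ν A + ν (∁ A)                                   ≤⟨ +-mono-≤ νA≤ ν∁A≤ ⟩
      ∣ S ∣ + ∣ T ∣                                   ≤⟨ separator-rank sep S⊆A T⊆∁A indS indT ⟩
      ν (S ∪ T)                                       ≤⟨ p⊆q⇒∣p∣≤∣q∣ V⊆ ⟩
      ∣ V G A ∪ V G (∁ A) ∣                           ≡⟨ +-identityʳ _ ⟨
      ∣ V G A ∪ V G (∁ A) ∣ + 0                       ∎))
    where
    open ≤-Reasoning
    V⊆ : V G (S ∪ T) ⊆ V G A ∪ V G (∁ A)
    V⊆ v∈ = ∪-least (λ v∈S → ∈∪ˡ (V-mono G S⊆A v∈S)) (λ v∈T → ∈∪ʳ (V-mono G T⊆∁A v∈T)) (V-∪ G S T v∈)

  -- Connected cacti-graphs have connected matroids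

  module _ (conn : IsConnectedGraph G) (no-isolated : NoIsolatedVertices G)
           (no-leaf : ∀ v → ¬ IsLeaf G v) where

    -- All edges at a vertex of `far` are outside `U`, so its degree in `∁ U` is at least 2; the
    -- boundary vertex `w` contributes one more. By the handshake identity `2c + 1` is at most twice
    -- `∣ ∁ U ∣`, and `c` is `n` minus `ν U`.
    degree-count : ∀ {U e f} → e ∈ U → f ∉ U → n < ν U + ∣ ∁ U ∣
    degree-count {U} {e} {f} e∈U f∉U with boundary G conn e∈U f∉U
    ... | w , w∈VU , w∈V∁U = ≰⇒> λ small → <-irrefl refl (begin-strict
      (c + c) + 0                               <⟨ +-monoʳ-< (c + c) (s≤s z≤n) ⟩
      (c + c) + 1                               ≡⟨ cong ((c + c) +_) (∣⁅x⁆∣≡1 w) ⟨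
      (c + c) + ∣ ⁅ w ⁆ ∣                        ≡⟨ cong₂ _+_ (cong₂ _+_ (sum-χ far) (sum-χ far)) (sum-χ ⁅ w ⁆) ⟨
      (sum (χ far) + sum (χ far)) + sum (χ ⁅ w ⁆) ≡⟨ cong (_+ sum (χ ⁅ w ⁆)) (∑-distrib-+ (χ far) (χ far)) ⟨
      sum (λ v → χ far v + χ far v) + sum (χ ⁅ w ⁆) ≡⟨ ∑-distrib-+ (λ v → χ far v + χ far v) (χ ⁅ w ⁆) ⟨
      sum (λ v → (χ far v + χ far v) + χ ⁅ w ⁆ v) ≤⟨ sum-mono bound ⟩
      sum (degree G (induced G (∁ U)))          ≡⟨ handshake G (∁ U) ⟩
      ∣ ∁ U ∣ + ∣ ∁ U ∣                         ≤⟨ +-mono-≤ (small′ small) (small′ small) ⟩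
      c + c                                     ≡⟨ +-identityʳ _ ⟨
      (c + c) + 0                               ∎)
      where
      open ≤-Reasoning
      far : Subset n
      far = ∁ (V G U)
      c : ℕ
      c = ∣ far ∣
      small′ : ν U + ∣ ∁ U ∣ ≤ n → ∣ ∁ U ∣ ≤ c
      small′ small = ≤-trans (m+n≤o⇒m≤o∸n ∣ ∁ U ∣ (subst (_≤ n) (+-comm (ν U) _) small))
        (≤-reflexive (sym (∣∁p∣≡n∸∣p∣ (V G U))))
      bound : ∀ v → (χ far v + χ far v) + χ ⁅ w ⁆ v ≤ degree G (induced G (∁ U)) v
      bound v with v ≟ᶠ w
      -- `w` is covered by `U`, hence not in `far`, and the left side is 0 + 0 + 1.
      ... | yes refl rewrite χ-∉ (λ v∈ → x∈∁p⇒x∉p v∈ w∈VU) | χ-∈ (x∈⁅x⁆ w) = degree≥1 G w∈V∁U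
      ... | no v≢w rewrite χ-∉ (x≢y⇒x∉⁅y⁆ v≢w) with v ∈? far
      ...   | no _ = z≤n
      ...   | yes v∈far = degree≥2 G
                (λ f∼v → x∉p⇒x∈∁p λ f∈U → x∈∁p⇒x∉p v∈far (incident-∈V G f∈U f∼v))
                (proj₂ (no-isolated v)) (no-leaf v)

    -- The complement of `U` contains no circuit, so it extends a full-rank independent subset of
    -- `U` to an independent set. This gives `ν U + ∣ ∁ U ∣ ≤ n`, against `degree-count`.
    every-edge-in-circuit : ∃ Circuit → ∀ e → e ∈ circuitElements
    every-edge-in-circuit (C , cC) e = decidable-stable (e ∈? U) λ e∉U →
      <⇒≱ (degree-count (circuit⊆ cC (proj₂ (circuit-nonempty cC))) e∉U)
          (rank-bound (full-rank U circuitElements-isUnion))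
      where
      open ≤-Reasoning
      U : Subset m
      U = circuitElements
      ind∁U : Independent (∁ U)
      ind∁U cD D⊆∁U = let (x , x∈D) = circuit-nonempty cD in x∈∁p⇒x∉p (D⊆∁U x∈D) (circuit⊆ cD x∈D)
      rank-bound : HasFullRank U → ν U + ∣ ∁ U ∣ ≤ n
      rank-bound (T , T⊆U , indT , νU≤) = begin
        ν U + ∣ ∁ U ∣       ≤⟨ +-monoˡ-≤ ∣ ∁ U ∣ νU≤ ⟩
        ∣ T ∣ + ∣ ∁ U ∣     ≤⟨ separator-rank (λ cD → inj₁ (circuit⊆ cD)) T⊆U ⊆-refl indT ind∁U ⟩
        ν (T ∪ ∁ U)         ≤⟨ ∣p∣≤n (V G (T ∪ ∁ U)) ⟩
        n                   ∎

    -- The class `A` of `e` is a separator by transitivity, and both `A` and `∁ A` are unions of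
    -- circuits, so their vertex sets are disjoint. If `f` were outside `A`, connectedness of the
    -- graph would give a shared vertex.
    every-pair-in-circuit : ∃ Circuit → ∀ e f → InCommonCircuit (M₁ G) e f
    every-pair-in-circuit exC e f = decidable-stable (inCommonCircuit? e f) λ none →
      separator-V-disjoint A-separates (full-rank A A-isUnion) (full-rank (∁ A) ∁A-isUnion)
        (boundary G conn e∈A λ f∈A → none (commonCircuit⁻ f∈A))
      where
      A : Subset m
      A = commonCircuitClass e
      e∈A : e ∈ A
      e∈A = commonCircuit⁺ (circuitElements⁻ (every-edge-in-circuit exC e))
      A-separates : IsSeparator A
      A-separates {C} cC with any? (λ x → (x ∈? C) ×-dec (x ∈? A))
      ... | yes (x , x∈C , x∈A) = inj₁ λ y∈C →
        commonCircuit⁺ (common-circuit-trans (M₁ G) (commonCircuit⁻ x∈A) (C , cC , x∈C , y∈C))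
      ... | no disjoint = inj₂ λ {y} y∈C → x∉p⇒x∈∁p λ y∈A → disjoint (y , y∈C , y∈A)
      A-isUnion : IsUnionOfCircuits A
      A-isUnion x∈A =
        let (D , cD , e∈D , x∈D) = commonCircuit⁻ x∈A
        in D , cD , x∈D , λ y∈D → commonCircuit⁺ (D , cD , e∈D , y∈D)
      ∁A-isUnion : IsUnionOfCircuits (∁ A)
      ∁A-isUnion {x} x∈∁A =
        let (D , cD , x∈D , _) = circuitElements⁻ (every-edge-in-circuit exC x) in
        D , cD , x∈D , λ y∈D →
          [ (λ D⊆A → ⊥-elim (x∈∁p⇒x∉p x∈∁A (D⊆A x∈D))) , (λ D⊆∁A → D⊆∁A y∈D) ]′ (A-separates cD)

  -- Connected matroids come from connected cacti-graphs

  dualIndependent? : ∀ X → Dec (DualIndependent X)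
  dualIndependent? X = anySubset? (λ B → maximal? independent? (∁ B) ×-dec (X ⊆? B))

  -- If the whole ground set were dually independent, the empty set would be a basis; but one edge
  -- alone is independent, since circuits have at least two edges. A minimal dually dependent set is
  -- then a cocircuit.
  cocircuit-exists : Fin m → ∃ Cocircuit
  cocircuit-exists e =
    let (K , min , _) = minimal-below (λ X → ¬? (dualIndependent? X)) ⊤-dependent (<-wellFounded _)
    in K , min
    where
    independent-single : Independent ⁅ e ⁆
    independent-single cC C⊆ = <⇒≱ (circuit-size cC)
      (≤-trans (p⊆q⇒∣p∣≤∣q∣ C⊆) (≤-reflexive (∣⁅x⁆∣≡1 e)))
    ⊤-dependent : ¬ DualIndependent ⊤
    ⊤-dependent (B , (_ , max) , ⊤⊆B) = x∈p⇒x∉∁p (⊤⊆B ∈⊤)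
      (subst (e ∈_) (max independent-single (λ x∈ → ⊥-elim (x∈∁p⇒x∉p x∈ (⊤⊆B ∈⊤)))) (x∈⁅x⁆ e))

  -- Adds one neighbouring vertex at a time until `W` is closed under incidence. This produces the
  -- vertex set of the component of `u` without having to decide `Star`.
  reachable : ∀ u (W : Subset n) → u ∈ W → (∀ {w} → w ∈ W → Star (Adjacent G (whole G)) u w) →
              Acc _<_ ∣ ∁ W ∣ →
              ∃[ W ] u ∈ W × (∀ {w} → w ∈ W → Star (Adjacent G (whole G)) u w) ×
                     (∀ e {x y} → Incident G e x → Incident G e y → x ∈ W → y ∈ W)
  reachable u W u∈W reach (acc rec)
    with any? (λ e → any? λ x → any? λ y →
                incident? G e x ×-dec incident? G e y ×-dec (x ∈? W) ×-dec ¬? (y ∈? W))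
  ... | no none = W , u∈W , reach , λ e {x} {y} e∼x e∼y x∈W →
    decidable-stable (y ∈? W) λ y∉W → none (e , x , y , e∼x , e∼y , x∈W , y∉W)
  ... | yes (e , x , y , e∼x , e∼y , x∈W , y∉W) =
    reachable u (W ∪ ⁅ y ⁆) (∈∪ˡ u∈W) reach′
      (rec (p⊂q⇒∣p∣<∣q∣ (p⊂q⇒∁p⊃∁q (∈∪ˡ , y , ∈∪ʳ (x∈⁅x⁆ y) , y∉W))))
    where
    joins : ∀ {x y} → Incident G e x → Incident G e y → x ≢ y → Joins G e x y
    joins (inj₁ refl) (inj₁ refl) x≢y = ⊥-elim (x≢y refl)
    joins (inj₁ refl) (inj₂ refl) x≢y = inj₁ refl
    joins (inj₂ refl) (inj₁ refl) x≢y = inj₂ refl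
    joins (inj₂ refl) (inj₂ refl) x≢y = ⊥-elim (x≢y refl)
    reach′ : ∀ {w} → w ∈ W ∪ ⁅ y ⁆ → Star (Adjacent G (whole G)) u w
    reach′ w∈ with x∈p∪q⁻ W ⁅ y ⁆ w∈
    ... | inj₁ w∈W = reach w∈W
    ... | inj₂ w∈y = subst (Star _ u) (sym (x∈⁅y⁆⇒x≡y y w∈y))
      (reach x∈W ◅◅ ((e , ∈⊤ , joins e∼x e∼y λ { refl → y∉W x∈W }) ◅ ε))

  -- If `v` were unreachable, `C` would split into proper subsets `A` and `B` with disjoint vertex
  -- sets. Neither has more edges than vertices, so neither would `C`.
  circuit-connected : ∀ {C e f u v} → Circuit C → e ∈ C → f ∈ C → Incident G e u → Incident G f v →
                      Star (Adjacent G (whole G)) u v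
  circuit-connected {C} {e} {f} {u} {v} cC e∈C f∈C e∼u f∼v
    with reachable u ⁅ u ⁆ (x∈⁅x⁆ u) (λ w∈ → subst (Star _ u) (sym (x∈⁅y⁆⇒x≡y u w∈)) ε) (<-wellFounded _)
  ... | W , u∈W , reach , closed with v ∈? W
  ... | yes v∈W = reach v∈W
  ... | no v∉W = ⊥-elim (<⇒≱ (circuit-over cC) (begin
    ∣ C ∣                         ≤⟨ ∣∣≤∣─∣+∣∩∣ C I ⟩
    ∣ B ∣ + ∣ A ∣                 ≤⟨ +-mono-≤ (proper⇒¬over G cC B⊂C) (proper⇒¬over G cC A⊂C) ⟩
    ν B + ν A                     ≡⟨ ∣∪∣-disjoint {p = V G B} {V G A} (λ x∈B x∈A → V-disjoint x∈A x∈B) ⟨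
    ∣ V G B ∪ V G A ∣             ≤⟨ p⊆q⇒∣p∣≤∣q∣ (∪-least (V-mono G (p─q⊆p C I)) (V-mono G (p∩q⊆p C I))) ⟩
    ν C                           ∎))
    where
    open ≤-Reasoning
    I A B : Subset m
    -- As `W` is closed under incidence, testing the first end settles both.
    I = separate (λ e → proj₁ (ends e) ∈? W)
    A = C ∩ I
    B = C ─ I
    I⁺ : ∀ {e x} → Incident G e x → x ∈ W → e ∈ I
    I⁺ {e} e∼x x∈W = ∈-separate⁺ (λ e → proj₁ (ends e) ∈? W) (closed e e∼x (inj₁ refl) x∈W)
    I⁻ : ∀ {e x} → e ∈ I → Incident G e x → x ∈ W
    I⁻ {e} e∈I e∼x = closed e (inj₁ refl) e∼x (∈-separate⁻ (λ e → proj₁ (ends e) ∈? W) e∈I)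
    A⊂C : A ⊂ C
    A⊂C = p∩q⊆p C I , f , f∈C , λ f∈A → v∉W (I⁻ (p∩q⊆q C I f∈A) f∼v)
    B⊂C : B ⊂ C
    B⊂C = p─q⊆p C I , e , e∈C , λ e∈B → x∈p─q⇒x∉q C I e∈B (I⁺ e∼u u∈W)
    V-disjoint : ∀ {x} → x ∈ V G A → x ∉ V G B
    V-disjoint x∈A x∈B with ∈V-incident G A x∈A | ∈V-incident G B x∈B
    ... | a , a∈A , a∼x | b , b∈B , b∼x =
      x∈p─q⇒x∉q C I b∈B (I⁺ b∼x (I⁻ (p∩q⊆q C I a∈A) a∼x))

  -- Removing `e` uncovers `v`, while the proper subset `C - e` has at most as many edges as
  -- vertices; hence `C` would not have more edges than vertices.
  circuit-no-leaf : ∀ {C e v} → Circuit C → e ∈ C → Incident G e v →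
                    ¬ (∀ f → Incident G f v → f ≡ e)
  circuit-no-leaf {C} {e} {v} cC e∈C e∼v only = <⇒≱ (circuit-over cC) (begin
    ∣ C ∣              ≤⟨ ∣p∣≤1+∣p-x∣ C e ⟩
    suc ∣ C - e ∣      ≤⟨ s≤s (proper⇒¬over G cC (x∈p⇒p-x⊂p e∈C)) ⟩
    suc (ν (C - e))    ≤⟨ p⊂q⇒∣p∣<∣q∣ (V-mono G (p─q⊆p C ⁅ e ⁆) , v , incident-∈V G e∈C e∼v , v∉) ⟩
    ν C                ∎)
    where
    open ≤-Reasoning
    v∉ : v ∉ V G (C - e)
    v∉ v∈ with ∈V-incident G (C - e) v∈
    ... | f , f∈ , f∼v = x∈p-y⇒x≢y C f∈ (only f f∼v)

  -- With degrees at most 2, the handshake identity on `C` would bound its edges by its vertices.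
  circuit-degree : ∀ {C} → Circuit C → ¬ (∀ v → degree G (whole G) v ≤ 2)
  circuit-degree {C} cC deg≤2 = <⇒≱ (+-mono-< (circuit-over cC) (circuit-over cC)) (begin
    ∣ C ∣ + ∣ C ∣                               ≡⟨ handshake G C ⟨
    sum (degree G (induced G C))                ≤⟨ sum-mono bound ⟩
    sum (λ v → χ (V G C) v + χ (V G C) v)       ≡⟨ ∑-distrib-+ (χ (V G C)) (χ (V G C)) ⟩
    sum (χ (V G C)) + sum (χ (V G C))           ≡⟨ cong₂ _+_ (sum-χ (V G C)) (sum-χ (V G C)) ⟩
    ν C + ν C                                   ∎)
    where
    open ≤-Reasoning
    bound : ∀ v → degree G (induced G C) v ≤ χ (V G C) v + χ (V G C) v
    bound v with v ∈? V G C
    ... | yes _ = ≤-trans (degree-mono G (induced G C) (whole G) v ((λ _ → ∈⊤) , (λ _ → ∈⊤))) (deg≤2 v)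
    ... | no v∉ = ≤-reflexive (degree≡0 G v∉)

mainTheorem15 : ∀ {n m : ℕ} (G : Graph n m) → NoIsolatedVertices G →
    (Matroid.NonTrivial (M₁ G) × IsConnectedGraph G × IsCactiGraph G)
    ⇔ Matroid.IsConnectedMatroid (M₁ G)
mainTheorem15 {n} {m} G no-isolated = mk⇔ to from
  where
  open Graph G
  open Matroid (M₁ G)

  to : NonTrivial × IsConnectedGraph G × IsCactiGraph G → IsConnectedMatroid
  to ((exC , _) , conn , _ , no-leaf , _) =
    ≤-trans (circuit-size G (proj₂ exC)) (∣p∣≤n (proj₁ exC)) ,
    λ e f _ → every-pair-in-circuit G conn no-isolated no-leaf exC e f

  from : IsConnectedMatroid → NonTrivial × IsConnectedGraph G × IsCactiGraph G
  from (s≤s (s≤s _) , pairs) =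
    ((_ , proj₁ (proj₂ (common zero zero))) , cocircuit-exists G zero) ,
    connected , no-isolated , no-leaf , no-cycle
    where
    common : ∀ e f → InCommonCircuit (M₁ G) e f
    common e f with e ≟ᶠ f
    ... | no e≢f = pairs e f e≢f
    -- There are at least two edges, so a circuit through `e` and any other edge serves for the pair
    -- `e`, `e`.
    common zero f | yes refl with pairs zero (suc zero) (λ ())
    ... | C , cC , e∈C , _ = C , cC , e∈C , e∈C
    common (suc e) f | yes refl with pairs (suc e) zero (λ ())
    ... | C , cC , e∈C , _ = C , cC , e∈C , e∈C

    connected : IsConnectedGraph G
    connected = (proj₁ (ends zero) , ∈⊤) , λ {u} {v} _ _ →
      let (e , e∼u) = no-isolated u
          (f , f∼v) = no-isolated v
          (C , cC , e∈C , f∈C) = common e f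
      in circuit-connected G cC e∈C f∈C e∼u f∼v

    no-leaf : ∀ v → ¬ IsLeaf G v
    no-leaf v (e , e∼v , only , _) =
      let (C , cC , e∈C , _) = common e e in circuit-no-leaf G cC e∈C e∼v only

    no-cycle : ∀ H → IsComponent G H → ¬ IsCycle G H
    -- A component of a connected graph is the whole graph, so a cycle component would make all
    -- degrees at most 2.
    no-cycle H (_ , maximal) (_ , 2-regular) =
      circuit-degree G (proj₁ (proj₂ (common zero zero))) λ v →
        ≤-trans (degree-mono G (whole G) H v whole⊑H) (≤-reflexive (2-regular (proj₁ whole⊑H ∈⊤)))
      where
      whole⊑H : whole G ⊑ H
      whole⊑H = maximal (whole G) connected ((λ _ → ∈⊤) , (λ _ → ∈⊤))
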